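{- Let $\lambda$ be a regular cardinal, let $\mathscr U=\{u\subseteq\lambda:\mathrm{cf}(\sup(u))\ne\mathrm{cf}(|u|)\}$, and let $\mathscr D$ be a fine normal filter on $\mathscr U$. Then there are functions $f^*_i$ for $i<\lambda^+$ with $\mathrm{Dom}(f^*_i)=\mathscr U$ and $f^*_i(u)\in u$ for all $u\in\mathscr U$, such that for all $i\ne j<\lambda^+$ the set $\{u\in\mathscr U:f^*_i(u)\ne f^*_j(u)\}$ belongs to $\mathscr D$.
   Context: A filter $\mathscr D$ on $\mathscr U\subseteq\mathcal P(\lambda)$ is fine if $\{u\in\mathscr U:\alpha\in u\}\in\mathscr D$ for every $\alpha<\lambda$, and normal if for every sequence $\langle X_\alpha:\alpha<\lambda\rangle$ of members of $\mathscr D$ the diagonal intersection $\{u\in\mathscr U:u\in X_\alpha\text{ for all }\alpha\in u\}$ belongs to $\mathscr D$. -}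

module Defs where

open import Axiom.ExcludedMiddle using (ExcludedMiddle)
open import Data.Bool.Base using (Bool; true; _∧_; T)
open import Data.Bool.Properties using (T-irrelevant)
open import Data.Nat.Base using (ℕ)
open import Data.Product.Base using (Σ-syntax; ∃-syntax; _×_; _,_; proj₁; proj₂)
open import Function.Base using (_on_; const)
open import Function.Bundles using (_↣_; _↔_)
open import Induction.WellFounded using (WellFounded)
open import Level using (Level; suc; _⊔_)
open import Relation.Binary.Core using (Rel)
open import Relation.Binary.Definitions using (Trichotomous; tri<; tri≈; tri>)
open import Relation.Binary.Morphism.Structures using (IsOrderIsomorphism)
open import Relation.Binary.PropositionalEquality.Core using (_≡_; refl; cong; resp₂)
open import Relation.Binary.PropositionalEquality.Properties using (isEquivalence)
open import Relation.Binary.Structures using (IsStrictTotalOrder)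
import Relation.Binary.Construct.On as On
open import Relation.Nullary.Decidable.Core using (does)
open import Relation.Nullary.Negation.Core using (¬_)
open import Relation.Unary using (Pred)

-- Set theory is rendered over classical type theory: excluded middle is a
-- parameter wherever it is needed.  Because `ExcludedMiddle` decides every type
-- (not only propositions), it also yields a choice function on inhabited types.

-- Under excluded middle every predicate is Bool-valued, so this is the full
-- power set; under function extensionality its equality is extensional.
𝒫 : ∀ {a} → Set a → Set a
𝒫 A = A → Bool

infix 4 _∈_ _⊆_

_∈_ : ∀ {a} {A : Set a} → A → 𝒫 A → Set
x ∈ X = T (X x)

_⊆_ : ∀ {a} {A : Set a} → 𝒫 A → 𝒫 A → Set a
X ⊆ Y = ∀ x → x ∈ X → x ∈ Y

_∩_ : ∀ {a} {A : Set a} → 𝒫 A → 𝒫 A → 𝒫 A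
(X ∩ Y) x = X x ∧ Y x

El : ∀ {a} {A : Set a} → 𝒫 A → Set a
El {A = A} X = Σ[ x ∈ A ] x ∈ X

-- Ordinals are well-ordered types, identified up to order isomorphism.
record WellOrder ℓ : Set (suc ℓ) where
  infix 4 _<_
  field
    Carrier            : Set ℓ
    _<_                : Rel Carrier ℓ
    isStrictTotalOrder : IsStrictTotalOrder _≡_ _<_
    wellFounded        : WellFounded _<_

  open IsStrictTotalOrder isStrictTotalOrder public
    using (compare; _<?_) renaming (trans to <-trans; irrefl to <-irrefl)

private
  variable
    ℓ d : Level

infix 4 _≅_

_≅_ : WellOrder ℓ → WellOrder ℓ → Set ℓ
A ≅ B = Σ[ f ∈ (A.Carrier → B.Carrier) ] IsOrderIsomorphism _≡_ _≡_ A._<_ B._<_ f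
  where
  module A = WellOrder A
  module B = WellOrder B

El-≡ : ∀ {a} {A : Set a} {X : 𝒫 A} {p q : El X} → proj₁ p ≡ proj₁ q → p ≡ q
El-≡ {p = x , m} {q = .x , n} refl = cong (x ,_) (T-irrelevant m n)

infix 5 _↾_ _↓_

_↾_ : (A : WellOrder ℓ) → 𝒫 (WellOrder.Carrier A) → WellOrder ℓ
A ↾ X = record
  { Carrier            = El X
  ; _<_                = _<_ on proj₁
  ; isStrictTotalOrder = record
    { isStrictPartialOrder = record
      { isEquivalence = isEquivalence
      ; irrefl        = λ p≡q → <-irrefl (cong proj₁ p≡q)
      ; trans         = <-trans
      ; <-resp-≈      = resp₂ (_<_ on proj₁)
      }
    ; compare = compare′
    }
  ; wellFounded        = On.wellFounded proj₁ wellFounded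
  }
  where
  open WellOrder A
  compare′ : Trichotomous {A = El X} _≡_ (_<_ on proj₁)
  compare′ p q with compare (proj₁ p) (proj₁ q)
  ... | tri< a ¬b ¬c = tri< a (λ e → ¬b (cong proj₁ e)) ¬c
  ... | tri≈ ¬a b ¬c = tri≈ ¬a (El-≡ b) ¬c
  ... | tri> ¬a ¬b c = tri> ¬a (λ e → ¬b (cong proj₁ e)) c

_↓_ : (A : WellOrder ℓ) → WellOrder.Carrier A → WellOrder ℓ
A ↓ y = A ↾ (λ x → does (x <? y))
  where open WellOrder A

Cofinal : (A : WellOrder ℓ) → 𝒫 (WellOrder.Carrier A) → Set ℓ
Cofinal A C = ∀ x → ∃[ c ] c ∈ C × ¬ (c < x)
  where open WellOrder A

infix 4 _≼_ _≺_

_≼_ : WellOrder ℓ → WellOrder ℓ → Set ℓ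
A ≼ B = WellOrder.Carrier A ↣ WellOrder.Carrier B

_≺_ : WellOrder ℓ → WellOrder ℓ → Set ℓ
A ≺ B = A ≼ B × ¬ (B ≼ A)

-- Properness is not required: the improper filter is allowed.
record IsFilter {A : Set ℓ} (𝒟 : Pred (𝒫 A) d) : Set (ℓ ⊔ d) where
  field
    whole        : 𝒟 (const true)
    upward       : ∀ {X Y} → 𝒟 X → X ⊆ Y → 𝒟 Y
    intersection : ∀ {X Y} → 𝒟 X → 𝒟 Y → 𝒟 (X ∩ Y)

module Classical {ℓ} (em : ExcludedMiddle ℓ) where

  compr : {A : Set ℓ} → Pred A ℓ → 𝒫 A
  compr P x = does (em {P x})

  syntax compr (λ x → P) = ｛ x ∣ P ｝

  -- The least ordinal β ≤ A such that P β, provided P A holds.  As in von Neumann's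
  -- representation, it is the set of its predecessors: those x such
  -- that P (A ↓ y) fails for every y ≤ x.
  least : Pred (WellOrder ℓ) ℓ → WellOrder ℓ → WellOrder ℓ
  least P A = A ↾ ｛ x ∣ (∀ y → ¬ (x < y) → ¬ P (A ↓ y)) ｝
    where open WellOrder A

  card : WellOrder ℓ → WellOrder ℓ
  card A = least (λ B → WellOrder.Carrier B ↔ WellOrder.Carrier A) A

  -- The least order type of a cofinal subset; thus cf 0 = 0 and cf (α + 1) = 1.
  cf : WellOrder ℓ → WellOrder ℓ
  cf A = least (λ B → ∃[ C ] Cofinal A C × (A ↾ C) ≅ B) A

  IsCardinal : WellOrder ℓ → Set ℓ
  IsCardinal A = card A ≅ A

  record IsRegularCardinal (A : WellOrder ℓ) : Set ℓ where
    field
      isCardinal : IsCardinal A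
      infinite   : ℕ ↣ WellOrder.Carrier A
      regular    : cf A ≅ A

  record IsSuccessorCardinal (A A⁺ : WellOrder ℓ) : Set (suc ℓ) where
    field
      isCardinal : IsCardinal A⁺
      greater    : A ≺ A⁺
      minimal    : ∀ B → IsCardinal B → A ≺ B → A⁺ ≼ B

  module _ (Λ : WellOrder ℓ) where
    open WellOrder Λ

    -- sup u is the union of u, i.e. the set of ordinals below some member of u.
    sup : 𝒫 Carrier → WellOrder ℓ
    sup u = Λ ↾ ｛ β ∣ (∃[ α ] α ∈ u × β < α) ｝

    𝒰 : 𝒫 (𝒫 Carrier)
    𝒰 = ｛ u ∣ ¬ (cf (sup u) ≅ cf (card (Λ ↾ u))) ｝

    module _ (𝒱 : 𝒫 (𝒫 Carrier)) (𝒟 : Pred (𝒫 (El 𝒱)) d) where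

      IsFine : Set (ℓ ⊔ d)
      IsFine = ∀ α → 𝒟 (λ u → proj₁ u α)

      diagonal : (Carrier → 𝒫 (El 𝒱)) → 𝒫 (El 𝒱)
      diagonal X = ｛ u ∣ (∀ α → α ∈ proj₁ u → u ∈ X α) ｝

      IsNormal : Set (ℓ ⊔ d)
      IsNormal = ∀ X → (∀ α → 𝒟 (X α)) → 𝒟 (diagonal X)

{-# OPTIONS --safe #-}

-- On λ⁺ there are relations R α, increasing in α < λ, with union
-- the order of λ⁺, such that { j ∣ R α j i } is an R α-chain on which functions to λ are bounded.
-- Hence there are functions g i : λ → λ with g j α ≢ g k α whenever j ≢ k are both R α-below a
-- common i.
--
-- Fix u with cf (sup u) ≢ cf |u|.  For every i there is εᵢ < |u| such that, for cofinally many
-- a ∈ u, both a and g i a are among the first εᵢ elements of u in an enumeration of length |u|: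
-- otherwise the two cofinalities would agree.  Let j be a rival of i if R a j i for some a ∈ u,
-- u is closed under g j, and εⱼ = εᵢ.  Sending each rival j to a pair (a , g j a) as above, with a
-- beyond the point where R a j i, is injective, so i has fewer than |u| rivals.  So i gets a label
-- δᵢ ∈ u distinct from those of its rivals, and f i u codes (εᵢ , δᵢ) by an element of u.  For
-- j < i, fineness gives R a j i for some a ∈ u, and normality gives closure under g j, for
-- 𝒟-almost every u; hence f j u ≢ f i u.
module Submission where

open import Defs
open import Axiom.ExcludedMiddle using (ExcludedMiddle)
open import Axiom.Extensionality.Propositional using (Extensionality)
open import Data.Bool.Base using (T; true; _∧_)
open import Data.Bool.Properties using (T?; T-∧)
open import Data.Empty using (⊥; ⊥-elim)
open import Data.Fin.Base using (Fin; zero; suc)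
import Data.Fin.Properties as Fin
open import Data.List.Base using (List; []; _∷_; length)
open import Data.List.Membership.Propositional using () renaming (_∈_ to _∈ˡ_)
open import Data.List.Membership.Setoid.Properties using (index-injective)
open import Data.List.Relation.Unary.Any using (here; there; index)
open import Data.Maybe.Base using (Maybe; just; nothing; maybe′)
open import Data.Maybe.Properties using (just-injective)
open import Data.Nat.Base as ℕ using (ℕ; zero; suc; _<′_; ≤′-step; <′-base)
open import Data.Nat.Properties using (<-cmp; ≤⇒≤′)
open import Data.Product.Base using (Σ-syntax; ∃-syntax; _×_; _,_; proj₁; proj₂)
open import Data.Product.Function.NonDependent.Propositional using (_×-↣_)
import Data.Product.Relation.Binary.Lex.Strict as Lex
open import Data.Sum.Base using (_⊎_; inj₁; inj₂)
open import Data.Unit.Base using (tt)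
open import Function.Base using (_∘_; id; _on_; case_of_)
open import Function.Bundles using (_↣_; _↔_; Equivalence; Injection; mk↣; mk⤖)
open import Function.Construct.Composition using (_↣-∘_)
open import Function.Properties.Bijection using (⤖⇒↔)
open import Function.Properties.Inverse using (↔-sym; ↔⇒↣)
open import Induction.WellFounded
  using (WellFounded; Acc; acc; module All; module FixPoint; module Subrelation)
open import Level using (Level)
open import Relation.Binary.Core using (Rel)
import Relation.Binary.Construct.On as On
open import Relation.Binary.Definitions using (Tri; tri<; tri≈; tri>)
open import Relation.Binary.Morphism.Structures using (IsOrderIsomorphism)
open import Relation.Binary.PropositionalEquality.Core
  using (_≡_; _≢_; refl; sym; trans; cong; cong₂; subst; subst₂)
open import Relation.Binary.PropositionalEquality.Properties
  using () renaming (setoid to ≡-setoid)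
open import Relation.Nullary.Decidable.Core using (Dec; yes; no; does)
open import Relation.Nullary.Negation.Core using (¬_)
open import Relation.Unary using (Pred)

-- Decidable membership and strictly monotone maps between well-orders.

T-does : ∀ {p} {P : Set p} (d : Dec P) → T (does d) → P
T-does (yes p) _ = p

does-T : ∀ {p} {P : Set p} (d : Dec P) → P → T (does d)
does-T (yes _) _ = tt
does-T (no ¬p) p = ⊥-elim (¬p p)

infix 4 _↪_

-- Strict monotonicity alone is recorded: by trichotomy such a map is also injective and reflects
-- the order.
record _↪_ {ℓ} (A B : WellOrder ℓ) : Set ℓ where
  constructor embed
  private
    module A = WellOrder A
    module B = WellOrder B
  field
    fun  : A.Carrier → B.Carrier
    mono : ∀ {x y} → x A.< y → fun x B.< fun y

module OrderLemmas {ℓ} (A : WellOrder ℓ) where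
  open WellOrder A

  asym : ∀ {x y} → x < y → ¬ (y < x)
  asym p q = <-irrefl refl (<-trans p q)

  ≤-<-trans : ∀ {x y z} → ¬ (y < x) → y < z → x < z
  ≤-<-trans {x} {y} y≮x y<z with compare x y
  ... | tri< x<y _ _ = <-trans x<y y<z
  ... | tri≈ _ refl _ = y<z
  ... | tri> _ _ y<x = ⊥-elim (y≮x y<x)

  <-≤-trans : ∀ {x y z} → x < y → ¬ (z < y) → x < z
  <-≤-trans {x} {y} {z} x<y z≮y with compare y z
  ... | tri< y<z _ _ = <-trans x<y y<z
  ... | tri≈ _ refl _ = x<y
  ... | tri> _ _ z<y = ⊥-elim (z≮y z<y)

  ≤-trans : ∀ {x y z} → ¬ (y < x) → ¬ (z < y) → ¬ (z < x)
  ≤-trans x≤y y≤z z<x = x≤y (≤-<-trans y≤z z<x)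

  ≤⇒<⊎≡ : ∀ {x y} → ¬ (y < x) → x < y ⊎ x ≡ y
  ≤⇒<⊎≡ {x} {y} y≮x with compare x y
  ... | tri< x<y _ _ = inj₁ x<y
  ... | tri≈ _ x≡y _ = inj₂ x≡y
  ... | tri> _ _ y<x = ⊥-elim (y≮x y<x)

  ≤-antisym : ∀ {x y} → ¬ (y < x) → ¬ (x < y) → x ≡ y
  ≤-antisym {x} {y} p q with compare x y
  ... | tri< x<y _ _ = ⊥-elim (q x<y)
  ... | tri≈ _ x≡y _ = x≡y
  ... | tri> _ _ y<x = ⊥-elim (p y<x)

  max : Carrier → Carrier → Carrier
  max x y with x <? y
  ... | yes _ = y
  ... | no _  = x

  max-≤ : ∀ x y → ¬ (max x y < x) × ¬ (max x y < y)
  max-≤ x y with x <? y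
  ... | yes x<y = asym x<y , <-irrefl refl
  ... | no x≮y  = <-irrefl refl , x≮y

  ∈↓ : ∀ {x y} → x < y → x ∈ (λ z → does (z <? y))
  ∈↓ {x} {y} = does-T (x <? y)

  ↓-< : ∀ {y} (z : WellOrder.Carrier (A ↓ y)) → proj₁ z < y
  ↓-< {y} (z , m) = T-does (z <? y) m

module _ {ℓ} {A B : WellOrder ℓ} (e : A ↪ B) where
  private
    module A = WellOrder A
    module B = WellOrder B
  open _↪_ e

  ↪-cancel : ∀ {x y} → fun x B.< fun y → x A.< y
  ↪-cancel {x} {y} fx<fy with A.compare x y
  ... | tri< x<y _ _ = x<y
  ... | tri≈ _ refl _ = ⊥-elim (B.<-irrefl refl fx<fy)
  ... | tri> _ _ y<x = ⊥-elim (OrderLemmas.asym B fx<fy (mono y<x))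

  ↪-injective : ∀ {x y} → fun x ≡ fun y → x ≡ y
  ↪-injective {x} {y} eq with A.compare x y
  ... | tri< x<y _ _ = ⊥-elim (B.<-irrefl eq (mono x<y))
  ... | tri≈ _ x≡y _ = x≡y
  ... | tri> _ _ y<x = ⊥-elim (B.<-irrefl (sym eq) (mono y<x))

  ↪-surjective⇒≅ : (∀ b → ∃[ a ] fun a ≡ b) → A ≅ B
  ↪-surjective⇒≅ surj = fun , record
    { isOrderMonomorphism = record
      { isOrderHomomorphism = record { cong = cong fun ; mono = mono }
      ; injective = ↪-injective
      ; cancel = ↪-cancel
      }
    ; surjective = λ b → proj₁ (surj b) , λ { refl → proj₂ (surj b) }
    }

↪-trans : ∀ {ℓ} {A B C : WellOrder ℓ} → A ↪ B → B ↪ C → A ↪ C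
↪-trans (embed f f-mono) (embed g g-mono) = embed (g ∘ f) (g-mono ∘ f-mono)

↾-↪ : ∀ {ℓ} (A : WellOrder ℓ) (X : 𝒫 (WellOrder.Carrier A)) → A ↾ X ↪ A
↾-↪ A X = embed proj₁ id

≅⇒↪ : ∀ {ℓ} {A B : WellOrder ℓ} → A ≅ B → A ↪ B
≅⇒↪ (f , iso) = embed f (IsOrderIsomorphism.mono iso)

≅⇒↪⁻¹ : ∀ {ℓ} {A B : WellOrder ℓ} → A ≅ B → B ↪ A
≅⇒↪⁻¹ {A = A} {B} (f , iso) = embed g λ {x} {y} x<y →
    cancel (subst₂ (WellOrder._<_ B) (sym (f∘g x)) (sym (f∘g y)) x<y)
  where
  open IsOrderIsomorphism iso
  g = λ b → proj₁ (surjective b)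
  f∘g : ∀ b → f (g b) ≡ b
  f∘g b = proj₂ (surjective b) refl

module Lemmas {ℓ} (em : ExcludedMiddle ℓ) (ext : Extensionality ℓ ℓ) where
  open Classical em

  dne : {P : Set ℓ} → ¬ ¬ P → P
  dne {P} ¬¬p with em {P}
  ... | yes p = p
  ... | no ¬p = ⊥-elim (¬¬p ¬p)

  find : {A : Set ℓ} {P : A → Set ℓ} → ¬ (∀ x → ¬ P x) → ∃[ x ] P x
  find h = dne λ ¬∃ → h λ x p → ¬∃ (x , p)

  ∈-compr : {A : Set ℓ} (P : A → Set ℓ) {x : A} → P x → x ∈ compr P
  ∈-compr _ = does-T em

  compr-∈ : {A : Set ℓ} (P : A → Set ℓ) {x : A} → x ∈ compr P → P x
  compr-∈ _ = T-does em

  -- Well-founded recursion and greedy choice.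

  module _ {X Y : Set ℓ} (_≺_ : Rel X ℓ) (d : X → Y) where

    -- Recursion steps take a total function, so no proofs of `p ≺ q` are carried around; off the
    -- predecessors of `q` the default `d` hides values not yet determined.
    mask : X → (X → Y) → X → Y
    mask q r p with em {p ≺ q}
    ... | yes _ = r p
    ... | no _  = d p

    mask-≡ : ∀ {q r p} → p ≺ q → mask q r p ≡ r p
    mask-≡ {q} {r} {p} p≺q with em {p ≺ q}
    ... | yes _ = refl
    ... | no p⊀q = ⊥-elim (p⊀q p≺q)

    recursion : WellFounded _≺_ → (F : X → (X → Y) → Y) →
                Σ[ r ∈ (X → Y) ] (∀ q → r q ≡ F q (mask q r))
    -- The function handed to `F` by the fixpoint agrees with `mask q r` only pointwise, so
    -- extensionality enters here.
    recursion wf F = r , λ q → trans (unfold-wfRec {q}) (cong (F q) (ext (step≡ q)))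
      where
      extend : ∀ q → (∀ {p} → p ≺ q → Y) → X → Y
      extend q ih p with em {p ≺ q}
      ... | yes p≺q = ih p≺q
      ... | no _    = d p

      extend-cong : ∀ q {ih ih′ : ∀ {p} → p ≺ q → Y} →
                    (∀ {p} (p≺q : p ≺ q) → ih p≺q ≡ ih′ p≺q) →
                    ∀ p → extend q ih p ≡ extend q ih′ p
      extend-cong q eq p with em {p ≺ q}
      ... | yes p≺q = eq p≺q
      ... | no _    = refl

      step : ∀ q → (∀ {p} → p ≺ q → Y) → Y
      step q ih = F q (extend q ih)

      open FixPoint wf (λ _ → Y) step
        (λ q eq → cong (F q) (ext (extend-cong q eq)))

      r : X → Y
      r = All.wfRec wf ℓ (λ _ → Y) step

      step≡ : ∀ q p → extend q (λ {p} _ → r p) p ≡ mask q r p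
      step≡ q p with em {p ≺ q}
      ... | yes _ = refl
      ... | no _  = refl

    -- The value at `q` is chosen to avoid the values already given to its predecessors. This
    -- produces injections along Gödel's order, the colourings of `R α` and the labels of rivals.
    greedy : WellFounded _≺_ →
             (∀ q (f : X → Y) → ∃[ y ] (∀ p → p ≺ q → f p ≢ y)) →
             Σ[ r ∈ (X → Y) ] (∀ {p q} → p ≺ q → r p ≢ r q)
    greedy wf avoid = r , λ {p} {q} p≺q eq →
        proj₂ (avoid q (mask q r)) p p≺q (trans (mask-≡ p≺q) (trans eq (r-≡ q)))
      where
      rec = recursion wf λ q f → proj₁ (avoid q f)
      r = proj₁ rec
      r-≡ = proj₂ rec

  -- Minima and comparison of well-orders.

  minimum : (A : WellOrder ℓ) → let open WellOrder A in (P : Carrier → Set ℓ) →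
            ∃[ x ] P x → ∃[ m ] P m × (∀ y → P y → ¬ (y < m))
  minimum A P (x , px) = go x (wellFounded x) px
    where
    open WellOrder A
    go : ∀ x → Acc _<_ x → P x → ∃[ m ] P m × (∀ y → P y → ¬ (y < m))
    go x (acc rs) px with em {∃[ y ] P y × y < x}
    ... | yes (y , py , y<x) = go y (rs y<x) py
    ... | no ¬∃ = x , px , λ y py y<x → ¬∃ (y , py , y<x)

  -- If `m` were least with `f m < m`, then `f m` would be a smaller such point.
  ↪-inflationary : {A : WellOrder ℓ} (e : A ↪ A) → let open WellOrder A in
                   ∀ x → ¬ (_↪_.fun e x < x)
  ↪-inflationary {A} (embed f f-mono) x fx<x =
    let m , fm<m , least = minimum A (λ y → f y < y) (x , fx<x) in least (f m) (f-mono fm<m) fm<m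
    where open WellOrder A

  -- The Mostowski collapse of X onto an initial segment of A.
  module Collapse {X A : WellOrder ℓ} (emb : X ↪ A) where
    private
      module X = WellOrder X
      module A = WellOrder A
      open OrderLemmas A
      open _↪_ emb renaming (fun to f; mono to f-mono)

    UpperBound : X.Carrier → (X.Carrier → A.Carrier) → A.Carrier → Set ℓ
    UpperBound x r a = ∀ x′ → x′ X.< x → r x′ A.< a

    leastBound : X.Carrier → (X.Carrier → A.Carrier) → A.Carrier
    leastBound x r with em {∃[ a ] UpperBound x r a}
    ... | yes ∃a = proj₁ (minimum A (UpperBound x r) ∃a)
    ... | no _   = f x

    leastBound-spec : ∀ x r a → UpperBound x r a →
      UpperBound x r (leastBound x r) × (∀ b → UpperBound x r b → ¬ (b A.< leastBound x r))
    leastBound-spec x r a ub with em {∃[ a ] UpperBound x r a}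
    ... | yes ∃a = proj₂ (minimum A (UpperBound x r) ∃a)
    ... | no ¬∃a = ⊥-elim (¬∃a (a , ub))

    private
      rec = recursion X._<_ f X.wellFounded leastBound

    π : X.Carrier → A.Carrier
    π = proj₁ rec

    private
      masked : X.Carrier → X.Carrier → A.Carrier
      masked x = mask X._<_ f x π

      masked-≡ : ∀ {x x′} → x′ X.< x → masked x x′ ≡ π x′
      masked-≡ = mask-≡ X._<_ f

    -- By induction `f x` is a strict bound of the earlier values of `π`, so the least such bound is
    -- at most `f x`. In particular the default of `leastBound` never arises here.
    π≤f : ∀ x → ¬ (f x A.< π x)
    π≤f = All.wfRec X.wellFounded ℓ _ λ x ih fx<πx →
      proj₂ (leastBound-spec x (masked x) (f x) (bound x ih)) (f x) (bound x ih)
        (subst (f x A.<_) (proj₂ rec x) fx<πx)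
      where
      bound : ∀ x → (∀ {y} → y X.< x → ¬ (f y A.< π y)) → UpperBound x (masked x) (f x)
      bound x ih x′ x′<x = subst (A._< f x) (sym (masked-≡ x′<x)) (≤-<-trans (ih x′<x) (f-mono x′<x))

    private
      spec : ∀ x → (∀ x′ → x′ X.< x → π x′ A.< π x) ×
                   (∀ b → UpperBound x π b → ¬ (b A.< π x))
      spec x = (λ x′ x′<x → subst₂ A._<_ (masked-≡ x′<x) (sym (proj₂ rec x)) (proj₁ s x′ x′<x)) ,
               λ b ub b<πx → proj₂ s b
                 (λ x′ x′<x → subst (A._< b) (sym (masked-≡ x′<x)) (ub x′ x′<x))
                 (subst (b A.<_) (proj₂ rec x) b<πx)
        where
        s = leastBound-spec x (masked x) (f x) λ x′ x′<x →
              subst (A._< f x) (sym (masked-≡ x′<x)) (≤-<-trans (π≤f x′) (f-mono x′<x))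

    π↪ : X ↪ A
    π↪ = embed π λ {x} {y} → proj₁ (spec y) x

    -- A point below `π x` is not a strict bound of the earlier values, so some earlier value
    -- reaches or exceeds it; induction applies to that value.
    π-initial : ∀ x y → y A.< π x → ∃[ x′ ] π x′ ≡ y
    π-initial = All.wfRec X.wellFounded ℓ _ λ x ih y y<πx →
      let x′ , h = find {P = λ x′ → x′ X.< x × ¬ (π x′ A.< y)} λ none →
                     proj₂ (spec x) y (λ x′ x′<x → dne λ n → none x′ (x′<x , n)) y<πx
      in hit x ih y x′ h
      where
      hit : ∀ x → (∀ {z} → z X.< x → ∀ y → y A.< π z → ∃[ x′ ] π x′ ≡ y) →
            ∀ y x′ → x′ X.< x × ¬ (π x′ A.< y) → ∃[ x′ ] π x′ ≡ y
      hit x ih y x′ (x′<x , πx′≮y) with ≤⇒<⊎≡ πx′≮y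
      ... | inj₁ y<πx′ = ih x′<x y y<πx′
      ... | inj₂ y≡πx′ = x′ , sym y≡πx′

    -- When `a` is missed, the range of `π` is exactly the segment below the least missed point.
    hit-or-≅↓ : ∀ a → (∃[ x ] π x ≡ a) ⊎ (∃[ y ] ¬ (a A.< y) × X ≅ A ↓ y)
    hit-or-≅↓ a with em {∃[ x ] π x ≡ a}
    ... | yes h = inj₁ h
    ... | no a∉π with minimum A (λ y → ¬ (∃[ x ] π x ≡ y)) (a , a∉π)
    ... | y , y∉π , least = inj₂ (y , least a a∉π ,
          ↪-surjective⇒≅ {A = X} {B = A ↓ y} (embed (λ x → π x , ∈↓ (below x)) (_↪_.mono π↪))
            λ { (z , m) → let x , e = dne (λ n → least z n (T-does (z A.<? y) m)) in x , El-≡ e })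
      where
      below : ∀ x → π x A.< y
      below x with A.compare (π x) y
      ... | tri< lt _ _ = lt
      ... | tri≈ _ eq _ = ⊥-elim (y∉π (x , eq))
      ... | tri> _ _ gt = ⊥-elim (y∉π (π-initial x y gt))

  -- If the collapse of `A` missed a point of `B`, then `B` would embed into a proper initial
  -- segment of itself.
  ↪-antisym : {A B : WellOrder ℓ} → A ↪ B → B ↪ A → A ≅ B
  ↪-antisym {A} {B} A↪B B↪A = ↪-surjective⇒≅ π↪ surj
    where
    open Collapse A↪B
    surj : ∀ b → ∃[ a ] π a ≡ b
    surj b with hit-or-≅↓ b
    ... | inj₁ h = h
    ... | inj₂ (y , _ , A≅B↓y) = ⊥-elim
      (↪-inflationary (↪-trans B↪B↓y (↾-↪ B _)) y (OrderLemmas.↓-< B (_↪_.fun B↪B↓y y)))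
      where
      B↪B↓y : B ↪ B ↓ y
      B↪B↓y = ↪-trans B↪A (≅⇒↪ {A = A} {B = B ↓ y} A≅B↓y)

  -- Cofinality and cardinality

  module _ {P : WellOrder ℓ → Set ℓ} {A : WellOrder ℓ} where
    open WellOrder A

    BelowWitnesses : Carrier → Set ℓ
    BelowWitnesses x = ∀ y → ¬ (x < y) → ¬ P (A ↓ y)

    leastSet : 𝒫 Carrier
    leastSet = compr BelowWitnesses

    least-attained : (∃[ y ] P (A ↓ y) × (∀ z → z < y → z ∈ leastSet)) ⊎ (∀ z → z ∈ leastSet)
    least-attained with em {∃[ y ] P (A ↓ y)}
    ... | no ¬∃ = inj₂ λ z → ∈-compr BelowWitnesses λ y _ py → ¬∃ (y , py)
    ... | yes ∃y with minimum A (λ y → P (A ↓ y)) ∃y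
    ... | y , py , least = inj₁ (y , py , λ z z<y → ∈-compr BelowWitnesses λ y′ z≮y′ py′ →
                             least y′ py′ (OrderLemmas.≤-<-trans A z≮y′ z<y))

    -- The inverse isomorphism embeds `A` into the subset, and its value at `y` is at least `y`;
    -- membership of that value excludes `P` at every point up to it.
    least≅⇒none : least P A ≅ A → ∀ y → ¬ P (A ↓ y)
    least≅⇒none iso y = compr-∈ BelowWitnesses (proj₂ (_↪_.fun A↪S y)) y
        (↪-inflationary (↪-trans A↪S (↾-↪ A leastSet)) y)
      where
      A↪S : A ↪ least P A
      A↪S = ≅⇒↪⁻¹ {A = least P A} {A} iso

    none⇒least≅ : (∀ y → ¬ P (A ↓ y)) → least P A ≅ A
    none⇒least≅ none = ↪-surjective⇒≅ (↾-↪ A leastSet) λ a → (a , ∈-compr BelowWitnesses λ y _ → none y) , refl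

  OrderTypeOfCofinal : WellOrder ℓ → WellOrder ℓ → Set ℓ
  OrderTypeOfCofinal A B = ∃[ C ] Cofinal A C × (A ↾ C) ≅ B

  cf-attained : (A : WellOrder ℓ) → ∃[ E ] Cofinal A E × (A ↾ E ↪ cf A)
  cf-attained A with least-attained {OrderTypeOfCofinal A} {A}
  ... | inj₁ (y , (E , E-cof , E≅) , below) = E , E-cof ,
        ↪-trans (≅⇒↪ {B = A ↓ y} E≅) (embed (λ z → proj₁ z , below _ (OrderLemmas.↓-< A z)) id)
  ... | inj₂ all = (λ _ → true) , (λ x → x , tt , WellOrder.<-irrefl A refl) ,
        embed (λ z → proj₁ z , all (proj₁ z)) id

  -- The collapse of `D` hits every point of `cf A`: a miss would make some `A ↓ y`, with `y` at
  -- most that point, the order type of a cofinal set.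
  cf-least : (A : WellOrder ℓ) (D : 𝒫 (WellOrder.Carrier A)) → Cofinal A D → cf A ↪ A ↾ D
  cf-least A D D-cof = embed (λ s → proj₁ (preimage s)) λ {s} {t} s<t →
      ↪-cancel π↪ (subst₂ A._<_ (sym (proj₂ (preimage s))) (sym (proj₂ (preimage t))) s<t)
    where
    module A = WellOrder A
    open Collapse (↾-↪ A D)
    preimage : ∀ s → ∃[ d ] π d ≡ proj₁ s
    preimage (s , s∈) with hit-or-≅↓ s
    ... | inj₁ h = h
    ... | inj₂ (y , s≮y , iso) = ⊥-elim (compr-∈ (BelowWitnesses {OrderTypeOfCofinal A} {A}) s∈ y s≮y (D , D-cof , iso))

  -- `D` consists of the values of `F` exceeding all earlier ones. The first value not below `a` is
  -- such a record, and records are attained in increasing order.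
  records : {E A : WellOrder ℓ} (F : WellOrder.Carrier E → WellOrder.Carrier A) →
            (∀ a → ∃[ e ] ¬ (WellOrder._<_ A (F e) a)) →
            ∃[ D ] Cofinal A D × (A ↾ D ↪ E)
  records {E} {A} F unbounded = D , D-cofinal , embed r r-mono
    where
    module E = WellOrder E
    module A = WellOrder A
    IsRecord : A.Carrier → Set ℓ
    IsRecord a = ∃[ e ] F e ≡ a × (∀ e′ → e′ E.< e → F e′ A.< F e)
    D = compr IsRecord
    D-cofinal : Cofinal A D
    D-cofinal a =
      let e , Fe≮a , least = minimum E (λ e → ¬ (F e A.< a)) (unbounded a)
      in F e , ∈-compr IsRecord (e , refl , λ e′ e′<e → OrderLemmas.<-≤-trans A
           (dne λ n → least e′ n e′<e) Fe≮a) , Fe≮a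
    r : El D → E.Carrier
    r (a , a∈) = proj₁ (compr-∈ IsRecord a∈)
    Fr≡ : ∀ d → F (r d) ≡ proj₁ d
    Fr≡ (a , a∈) = proj₁ (proj₂ (compr-∈ IsRecord a∈))
    r-mono : ∀ {d d′} → proj₁ d A.< proj₁ d′ → r d E.< r d′
    r-mono {d} {d′} d<d′ with E.compare (r d) (r d′)
    ... | tri< lt _ _ = lt
    ... | tri≈ _ eq _ = ⊥-elim (A.<-irrefl (trans (sym (Fr≡ d)) (trans (cong F eq) (Fr≡ d′))) d<d′)
    ... | tri> _ _ gt = ⊥-elim (OrderLemmas.asym A d<d′ (subst₂ A._<_ (Fr≡ d′) (Fr≡ d)
                          (proj₂ (proj₂ (compr-∈ IsRecord (proj₂ d))) (r d′) gt)))

  -- Being eventually large, unlike being merely unbounded, survives restriction to a cofinal subset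
  -- of `B` of order type at most `cf B`; `records` then applies.
  convergent⇒cf-↪ : {A B : WellOrder ℓ} (F : WellOrder.Carrier B → WellOrder.Carrier A) →
    (∀ a → ∃[ b ] (∀ b′ → ¬ (WellOrder._<_ B b′ b) → ¬ (WellOrder._<_ A (F b′) a))) →
    cf A ↪ cf B
  convergent⇒cf-↪ {A} {B} F conv =
    let E , E-cof , E↪ = cf-attained B
        D , D-cof , r = records {B ↾ E} {A} (F ∘ proj₁) λ a →
          let b , h = conv a
              e , e∈ , e≮b = E-cof b
          in (e , e∈) , h e e≮b
    in ↪-trans (cf-least A D D-cof) (↪-trans r E↪)

  InImage : {X Y : Set ℓ} → (X → Y) → Y → Set ℓ
  InImage h y = ∃[ x ] h x ≡ y

  -- The collapse of the image cannot reach `x`, since it only moves points down; so the image is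
  -- isomorphic to a segment `A ↓ y`.
  injective-below⇒↔↓ : {A : WellOrder ℓ} {X : Set ℓ} (h : X ↣ WellOrder.Carrier A) →
    ∀ {x} → (∀ z → WellOrder._<_ A (Injection.to h z) x) →
    ∃[ y ] ¬ (WellOrder._<_ A x y) × (WellOrder.Carrier (A ↓ y) ↔ X)
  injective-below⇒↔↓ {A} {X} h {x} h<x with Collapse.hit-or-≅↓ (↾-↪ A D) x
    where D = compr (InImage (Injection.to h))
  ... | inj₁ (d , πd≡x) = ⊥-elim (Collapse.π≤f (↾-↪ A _) d
          (subst (proj₁ d A.<_) (sym πd≡x) (subst (A._< x) (proj₂ (compr-∈ (InImage (Injection.to h)) (proj₂ d))) (h<x _))))
    where module A = WellOrder A
  ... | inj₂ (y , x≮y , (k , iso)) = y , x≮y , ↔-sym (⤖⇒↔ (mk⤖ {to = to} (inj , surj)))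
    where
    open IsOrderIsomorphism iso using (injective; surjective)
    to : X → WellOrder.Carrier (A ↓ y)
    to z = k (Injection.to h z , ∈-compr (InImage (Injection.to h)) (z , refl))
    inj : ∀ {z z′} → to z ≡ to z′ → z ≡ z′
    inj eq = Injection.injective h (cong proj₁ (injective eq))
    surj : ∀ b → ∃[ z ] (∀ {z′} → z′ ≡ z → to z′ ≡ b)
    surj b with surjective b
    ... | (a , a∈) , e = let z , hz≡a = compr-∈ (InImage (Injection.to h)) a∈ in z , λ { refl → e (El-≡ hz≡a) }

  card-↣ : (A : WellOrder ℓ) → WellOrder.Carrier A ↣ WellOrder.Carrier (card A)
  card-↣ A with least-attained {λ B → WellOrder.Carrier B ↔ WellOrder.Carrier A} {A}
  ... | inj₁ (y , A↓y↔A , below) =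
        mk↣ {to = λ z → proj₁ z , below _ (OrderLemmas.↓-< A z)} (λ eq → El-≡ (cong proj₁ eq))
        ↣-∘ ↔⇒↣ (↔-sym A↓y↔A)
  ... | inj₂ all = mk↣ {to = λ z → z , all z} (cong proj₁)

  card-initial : (A : WellOrder ℓ) → ∀ x → ¬ (WellOrder.Carrier A ↣ WellOrder.Carrier (card A ↓ x))
  card-initial A x h =
    let y , x≮y , A↓y↔A = injective-below⇒↔↓ {A} (mk↣ {to = proj₁ ∘ proj₁} (El-≡ ∘ El-≡) ↣-∘ h)
                            {proj₁ x} (λ z → OrderLemmas.↓-< (card A) {x} (Injection.to h z))
    in compr-∈ (BelowWitnesses {λ B → WellOrder.Carrier B ↔ WellOrder.Carrier A} {A}) (proj₂ x) y x≮y A↓y↔A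

  -- Squares of infinite well-orders

  finite-or-infinite : (X : Set ℓ) → (∃[ n ] X ↣ Fin n) ⊎ (ℕ ↣ X)
  finite-or-infinite X with em {∃[ xs ] (∀ (x : X) → x ∈ˡ xs)}
  ... | yes (xs , all) = inj₁ (length xs , mk↣ {to = λ x → index (all x)}
          (index-injective (≡-setoid X) (all _) (all _)))
  ... | no ¬∃ = inj₂ (mk↣ {to = s} s-injective)
    where
    fresh : ∀ xs → ∃[ x ] ¬ (x ∈ˡ xs)
    fresh xs = find λ none → ¬∃ (xs , λ x → dne (none x))
    initial : ℕ → List X
    s : ℕ → X
    initial zero    = []
    initial (suc n) = s n ∷ initial n
    s n = proj₁ (fresh (initial n))
    earlier : ∀ {m n} → m <′ n → s m ∈ˡ initial n
    earlier <′-base       = here refl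
    earlier (≤′-step m<n) = there (earlier m<n)
    s-≢ : ∀ {m n} → m <′ n → s m ≢ s n
    s-≢ {m} {n} m<n eq = proj₂ (fresh (initial n)) (subst (_∈ˡ initial n) eq (earlier m<n))
    s-injective : ∀ {m n} → s m ≡ s n → m ≡ n
    s-injective {m} {n} eq with <-cmp m n
    ... | tri< m<n _ _ = ⊥-elim (s-≢ (≤⇒≤′ m<n) eq)
    ... | tri≈ _ m≡n _ = m≡n
    ... | tri> _ _ n<m = ⊥-elim (s-≢ (≤⇒≤′ n<m) (sym eq))

  -- Shifting along the embedded copy of the naturals frees `ν 0` for the extra point.
  hilbertHotel : {X : Set ℓ} → ℕ ↣ X → Maybe X ↣ X
  hilbertHotel {X} e = mk↣ {to = to} injective
    where
    open Injection e using () renaming (to to ν; injective to ν-injective)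
    shift : ∀ x → Dec (∃[ n ] ν n ≡ x) → X
    shift x (yes (n , _)) = ν (suc n)
    shift x (no _)        = x
    to : Maybe X → X
    to nothing  = ν 0
    to (just x) = shift x em
    shift-≢0 : ∀ x d → shift x d ≢ ν 0
    shift-≢0 x (yes _) eq with () ← ν-injective eq
    shift-≢0 x (no x∉ν) eq = x∉ν (0 , sym eq)
    shift-injective : ∀ {x y} d d′ → shift x d ≡ shift y d′ → x ≡ y
    shift-injective (yes (m , νm≡x)) (yes (n , νn≡y)) eq with refl ← ν-injective eq =
      trans (sym νm≡x) νn≡y
    shift-injective (yes (m , _)) (no y∉ν) eq = ⊥-elim (y∉ν (suc m , eq))
    shift-injective (no x∉ν) (yes (n , _)) eq = ⊥-elim (x∉ν (suc n , sym eq))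
    shift-injective (no _) (no _) eq = eq
    injective : ∀ {x y} → to x ≡ to y → x ≡ y
    injective {nothing} {nothing} _  = refl
    injective {nothing} {just y}  eq = ⊥-elim (shift-≢0 y em (sym eq))
    injective {just x}  {nothing} eq = ⊥-elim (shift-≢0 x em eq)
    injective {just x}  {just y}  eq = cong just (shift-injective em em eq)

  Maybe-↣-Fin : ∀ {X : Set ℓ} {n} → X ↣ Fin n → Maybe X ↣ Fin (suc n)
  Maybe-↣-Fin h = mk↣ {to = to} injective
    where
    to = maybe′ (λ x → suc (Injection.to h x)) zero
    injective : ∀ {x y} → to x ≡ to y → x ≡ y
    injective {nothing} {nothing} _  = refl
    injective {just x}  {just y}  eq = cong just (Injection.injective h (Fin.suc-injective eq))

  SquareInjects : WellOrder ℓ → Set ℓ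
  SquareInjects A = ℕ ↣ WellOrder.Carrier A →
                    (WellOrder.Carrier A × WellOrder.Carrier A) ↣ WellOrder.Carrier A

  module _ (A : WellOrder ℓ) where
    open WellOrder A
    open OrderLemmas A

    InjectsIntoSquare≤ : Set ℓ → Carrier → Set ℓ
    InjectsIntoSquare≤ X p = Σ[ ψ ∈ X ↣ (Carrier × Carrier) ]
      (∀ x → let a , b = Injection.to ψ x in ¬ (p < a) × ¬ (p < b))

    -- The points up to `p` form `Y` with one extra point. A finite `Y` would bound the infinite
    -- `X`; an infinite `Y` absorbs the extra point and then the square.
    square≤⇒↓ : ∀ {X p} → ℕ ↣ X → SquareInjects (A ↓ p) → InjectsIntoSquare≤ X p →
                X ↣ WellOrder.Carrier (A ↓ p)
    square≤⇒↓ {X} {p} ν sq (ψ , ψ≤p) = conclude (finite-or-infinite Y)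
      where
      Y = WellOrder.Carrier (A ↓ p)
      cap : ∀ a → Dec (a < p) → Maybe Y
      cap a (yes a<p) = just (a , ∈↓ a<p)
      cap a (no _)    = nothing
      cap-injective : ∀ {a b} d d′ → ¬ (p < a) → ¬ (p < b) → cap a d ≡ cap b d′ → a ≡ b
      cap-injective (yes _) (yes _) _ _ eq = cong proj₁ (just-injective eq)
      cap-injective (no a≮p) (no b≮p) p≮a p≮b _ =
        trans (≤-antisym p≮a a≮p) (≤-antisym b≮p p≮b)
      capped : X ↣ (Maybe Y × Maybe Y)
      capped = mk↣ {to = λ x → let a , b = Injection.to ψ x in cap a (a <? p) , cap b (b <? p)}
        λ {x} {y} eq → Injection.injective ψ (cong₂ _,_
          (cap-injective (_ <? p) (_ <? p) (proj₁ (ψ≤p x)) (proj₁ (ψ≤p y)) (cong proj₁ eq))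
          (cap-injective (_ <? p) (_ <? p) (proj₂ (ψ≤p x)) (proj₂ (ψ≤p y)) (cong proj₂ eq)))
      conclude : (∃[ n ] Y ↣ Fin n) ⊎ (ℕ ↣ Y) → X ↣ Y
      conclude (inj₁ (n , h)) = ⊥-elim (Fin.ℕ→Fin-notInjective _ (Injection.injective
        (↔⇒↣ (↔-sym Fin.*↔×) ↣-∘ ((Maybe-↣-Fin h ×-↣ Maybe-↣-Fin h) ↣-∘ (capped ↣-∘ ν)))))
      conclude (inj₂ h) = sq h ↣-∘ ((hilbertHotel h ×-↣ hilbertHotel h) ↣-∘ capped)

    private
      key : Carrier × Carrier → Carrier × (Carrier × Carrier)
      key (a , b) = max a b , a , b
      _⊏₂_ = Lex.×-Lex _≡_ _<_ _<_
      _⊏₃_ = Lex.×-Lex _≡_ _<_ _⊏₂_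
      -- Gödel's well-ordering of pairs: the predecessors of q lie in the square of max q.
      _⊏_ = _⊏₃_ on key

      ⊏-wellFounded : WellFounded _⊏_
      ⊏-wellFounded = On.wellFounded key
        (Lex.×-wellFounded wellFounded (Lex.×-wellFounded wellFounded wellFounded))

      ⊏-connex : ∀ p q → p ⊏ q ⊎ p ≡ q ⊎ q ⊏ p
      ⊏-connex p q with Lex.×-compare sym compare (Lex.×-compare sym compare compare) (key p) (key q)
      ... | tri< lt _ _ = inj₁ lt
      ... | tri≈ _ (_ , e₁ , e₂) _ = inj₂ (inj₁ (cong₂ _,_ e₁ e₂))
      ... | tri> _ _ gt = inj₂ (inj₂ gt)

      ⊏⇒max≤ : ∀ p q → p ⊏ q → ¬ (max (proj₁ q) (proj₂ q) < max (proj₁ p) (proj₂ p))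
      ⊏⇒max≤ p q (inj₁ lt)      = asym lt
      ⊏⇒max≤ p q (inj₂ (e , _)) = <-irrefl (sym e)

    -- Values are chosen greedily along Gödel's order. If none were free at `q`, choosing a preimage
    -- of each point would inject the whole carrier into a closed square.
    noSquare≤⇒square : ℕ ↣ Carrier → (∀ p → ¬ InjectsIntoSquare≤ Carrier p) → (Carrier × Carrier) ↣ Carrier
    noSquare≤⇒square ν none = mk↣ {to = r} λ {p} {q} eq → separate eq (⊏-connex p q)
      where
      module _ (q : Carrier × Carrier) (f : Carrier × Carrier → Carrier)
               (pre : ∀ y → ∃[ p ] p ⊏ q × f p ≡ y) where
        pre-injective : ∀ {y z} → proj₁ (pre y) ≡ proj₁ (pre z) → y ≡ z
        pre-injective {y} {z} e =
          trans (sym (proj₂ (proj₂ (pre y)))) (trans (cong f e) (proj₂ (proj₂ (pre z))))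
        pre-≤ : ∀ y → let a , b = proj₁ (pre y) in
                ¬ (max (proj₁ q) (proj₂ q) < a) × ¬ (max (proj₁ q) (proj₂ q) < b)
        pre-≤ y with pre y
        ... | (a , b) , p⊏q , _ = ≤-trans (proj₁ (max-≤ a b)) (⊏⇒max≤ (a , b) q p⊏q) ,
                                  ≤-trans (proj₂ (max-≤ a b)) (⊏⇒max≤ (a , b) q p⊏q)
      avoid : ∀ q (f : Carrier × Carrier → Carrier) → ∃[ y ] (∀ p → p ⊏ q → f p ≢ y)
      avoid q f = find λ h →
        let pre : ∀ y → ∃[ p ] p ⊏ q × f p ≡ y
            pre y = find λ n → h y λ p p⊏q e → n p (p⊏q , e)
        in none (max (proj₁ q) (proj₂ q))
             (mk↣ {to = λ y → proj₁ (pre y)} (pre-injective q f pre) , pre-≤ q f pre)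
      chosen : Σ[ r ∈ (Carrier × Carrier → Carrier) ] (∀ {p q} → p ⊏ q → r p ≢ r q)
      chosen = greedy _⊏_ (λ _ → Injection.to ν 0) ⊏-wellFounded avoid
      r = proj₁ chosen
      separate : ∀ {p q} → r p ≡ r q → p ⊏ q ⊎ p ≡ q ⊎ q ⊏ p → p ≡ q
      separate {p} {q} eq (inj₁ p⊏q)        = ⊥-elim (proj₂ chosen {p} {q} p⊏q eq)
      separate         eq (inj₂ (inj₁ p≡q)) = p≡q
      separate {p} {q} eq (inj₂ (inj₂ q⊏p)) = ⊥-elim (proj₂ chosen {q} {p} q⊏p (sym eq))

    ↓-↣ : ∀ p → WellOrder.Carrier (A ↓ p) ↣ Carrier
    ↓-↣ p = mk↣ {to = proj₁} El-≡

    square-step : (∀ p → SquareInjects (A ↓ p)) → SquareInjects A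
    square-step sq ν with em {∃[ p ] Carrier ↣ WellOrder.Carrier (A ↓ p)}
    ... | yes (p , h) = ↓-↣ p ↣-∘ (sq p (h ↣-∘ ν) ↣-∘ (h ×-↣ h))
    ... | no ¬h = noSquare≤⇒square ν λ p ψ → ¬h (p , square≤⇒↓ ν (sq p) ψ)

  -- Iterated segments are different types, but all embed into the fixed `A`; the induction runs on
  -- the bound `a` there.
  square-↓ : {A B : WellOrder ℓ} (e : B ↪ A) (a : WellOrder.Carrier A) →
             (∀ b → WellOrder._<_ A (_↪_.fun e b) a) → SquareInjects B
  square-↓ {A} {B} e a = go e a (wellFounded a)
    where
    open WellOrder A
    go : {B : WellOrder ℓ} (e : B ↪ A) (a : Carrier) → Acc _<_ a →
         (∀ b → _↪_.fun e b < a) → SquareInjects B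
    go {B} e a (acc rs) e<a = square-step B λ p →
      go (↪-trans (↾-↪ B _) e) (_↪_.fun e p) (rs (e<a p)) λ b → _↪_.mono e (OrderLemmas.↓-< B b)

  square : (A : WellOrder ℓ) → SquareInjects A
  square A = square-step A λ p → square-↓ (↾-↪ A _) p (OrderLemmas.↓-< A)

  -- Regular cardinals and their successors

  module Regular (Λ : WellOrder ℓ) (reg : IsRegularCardinal Λ) where
    open WellOrder Λ
    open OrderLemmas Λ
    open IsRegularCardinal reg

    zeroΛ : Carrier
    zeroΛ = Injection.to infinite 0

    -- An unbounded `F` would give, by `records`, a cofinal set embedded in `Λ ↓ α`, hence one whose
    -- order type is a proper initial segment of `Λ`, against regularity.
    bounded : ∀ α (F : Carrier → Carrier) → ∃[ b ] (∀ z → z < α → F z < b)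
    bounded α F = find λ unbounded →
      let D , D-cof , r = records {Λ ↓ α} {Λ} (F ∘ proj₁) λ b →
            let z , n = find {P = λ z → ¬ (z < α → F z < b)} λ h → unbounded b λ z → dne (h z)
                z<α = dne λ z≮α → n λ z<α → ⊥-elim (z≮α z<α)
            in (z , ∈↓ z<α) , λ lt → n λ _ → lt
      in refute D D-cof r
      where
      refute : ∀ D → Cofinal Λ D → Λ ↾ D ↪ Λ ↓ α → ⊥
      refute D D-cof r with Collapse.hit-or-≅↓ (↪-trans r (↾-↪ Λ _)) α
      ... | inj₁ (d , πd≡α) = Collapse.π≤f (↪-trans r (↾-↪ Λ _)) d
              (subst (proj₁ (_↪_.fun r d) <_) (sym πd≡α) (↓-< (_↪_.fun r d)))
      ... | inj₂ (y , _ , iso) = least≅⇒none {OrderTypeOfCofinal Λ} {Λ} regular y (D , D-cof , iso)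

    -- A maximum would make a singleton cofinal, and regularity would embed the infinite `Λ` into
    -- it.
    noMax : ∀ a → ∃[ b ] a < b
    noMax a = find λ a-max →
      let D = compr (_≡ a)
          Λ↪D : Λ ↪ Λ ↾ D
          Λ↪D = ↪-trans (≅⇒↪⁻¹ {A = cf Λ} regular) (cf-least Λ D λ x → a , ∈-compr (_≡ a) refl , a-max x)
          constant : ∀ x → proj₁ (_↪_.fun Λ↪D x) ≡ a
          constant x = compr-∈ (_≡ a) (proj₂ (_↪_.fun Λ↪D x))
          0≡1 = Injection.injective infinite {0} {1}
                  (↪-injective Λ↪D (El-≡ (trans (constant _) (sym (constant _)))))
      in case 0≡1 of λ ()

  module Successor {Λ Λ⁺ : WellOrder ℓ} (isSuc : IsSuccessorCardinal Λ Λ⁺) where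
    private
      module Λ = WellOrder Λ
    open WellOrder Λ⁺
    open OrderLemmas Λ⁺
    open IsSuccessorCardinal isSuc

    noInjection↓ : ∀ y → ¬ (Carrier ↣ WellOrder.Carrier (Λ⁺ ↓ y))
    noInjection↓ y h =
      let y′ , _ , Λ⁺↓y′↔Λ⁺ = injective-below⇒↔↓ {Λ⁺} (↓-↣ Λ⁺ y ↣-∘ h) {y} λ z → ↓-< (Injection.to h z)
      in least≅⇒none {λ B → WellOrder.Carrier B ↔ Carrier} {Λ⁺} isCardinal y′ Λ⁺↓y′↔Λ⁺

    ↓-mono : ∀ {x y} → ¬ (y < x) → WellOrder.Carrier (Λ⁺ ↓ x) ↣ WellOrder.Carrier (Λ⁺ ↓ y)
    ↓-mono {x} {y} y≮x = mk↣ {to = λ z → proj₁ z , ∈↓ (<-≤-trans (↓-< z) y≮x)} λ eq → El-≡ (cong proj₁ eq)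

    module _ (e : Λ.Carrier ↣ Carrier) where
      private
        D = compr (InImage (Injection.to e))
        open Collapse (↾-↪ Λ⁺ D)

        Λ↣D : Λ.Carrier ↣ El D
        Λ↣D = mk↣ {to = λ z → Injection.to e z , ∈-compr (InImage (Injection.to e)) (z , refl)}
                λ eq → Injection.injective e (cong proj₁ eq)

        D↣Λ : El D ↣ Λ.Carrier
        D↣Λ = mk↣ {to = λ d → proj₁ (pre d)} λ {d} {d′} eq →
            El-≡ (trans (sym (proj₂ (pre d))) (trans (cong (Injection.to e) eq) (proj₂ (pre d′))))
          where
          pre : ∀ d → InImage (Injection.to e) (proj₁ d)
          pre d = compr-∈ (InImage (Injection.to e)) (proj₂ d)

      -- The copy `D` of `Λ` is collapsed in `Λ⁺`: if `y` is hit, everything below it is a collapsed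
      -- value; otherwise `D` fills a segment no longer than that of `y`.
      ↓-comparable : ∀ y → (WellOrder.Carrier (Λ⁺ ↓ y) ↣ Λ.Carrier) ⊎ (Λ.Carrier ↣ WellOrder.Carrier (Λ⁺ ↓ y))
      ↓-comparable y with hit-or-≅↓ y
      ... | inj₂ (y′ , y≮y′ , (k , iso)) =
            inj₂ (↓-mono y≮y′ ↣-∘ (mk↣ {to = k} (IsOrderIsomorphism.injective iso) ↣-∘ Λ↣D))
      ... | inj₁ (d , πd≡y) = inj₁ (D↣Λ ↣-∘ mk↣ {to = λ z → proj₁ (pre z)} λ {z} {z′} eq →
              El-≡ (trans (sym (proj₂ (pre z))) (trans (cong π eq) (proj₂ (pre z′)))))
        where
        pre : ∀ z → ∃[ d′ ] π d′ ≡ proj₁ z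
        pre z = π-initial d (proj₁ z) (subst (proj₁ z <_) (sym πd≡y) (↓-< z))

    -- The segment at the least counterexample `y` is a cardinal by leastness and exceeds `Λ` by
    -- comparability. Minimality of `Λ⁺` then injects `Λ⁺` into its own segment.
    ↓-↣Λ : ∀ i → WellOrder.Carrier (Λ⁺ ↓ i) ↣ Λ.Carrier
    ↓-↣Λ i = dne λ ¬h →
      let y , ¬y↣Λ , least = minimum Λ⁺ (λ y → ¬ (WellOrder.Carrier (Λ⁺ ↓ y) ↣ Λ.Carrier)) (i , ¬h)
      in refute y ¬y↣Λ least (↓-comparable (proj₁ greater) y)
      where
      refute : ∀ y → ¬ (WellOrder.Carrier (Λ⁺ ↓ y) ↣ Λ.Carrier) →
               (∀ x → ¬ (WellOrder.Carrier (Λ⁺ ↓ x) ↣ Λ.Carrier) → ¬ (x < y)) →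
               (WellOrder.Carrier (Λ⁺ ↓ y) ↣ Λ.Carrier) ⊎ (Λ.Carrier ↣ WellOrder.Carrier (Λ⁺ ↓ y)) → ⊥
      refute y ¬y↣Λ least (inj₁ h) = ¬y↣Λ h
      refute y ¬y↣Λ least (inj₂ h) = noInjection↓ y
        (minimal (Λ⁺ ↓ y)
          (none⇒least≅ {λ B → WellOrder.Carrier B ↔ WellOrder.Carrier (Λ⁺ ↓ y)} {Λ⁺ ↓ y} initial)
          (h , ¬y↣Λ))
        where
        initial : ∀ x → ¬ (WellOrder.Carrier ((Λ⁺ ↓ y) ↓ x) ↔ WellOrder.Carrier (Λ⁺ ↓ y))
        initial x bij = least (proj₁ x) (λ x↣Λ → ¬y↣Λ (x↣Λ ↣-∘ (flatten ↣-∘ ↔⇒↣ (↔-sym bij)))) (↓-< x)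
          where
          flatten : WellOrder.Carrier ((Λ⁺ ↓ y) ↓ x) ↣ WellOrder.Carrier (Λ⁺ ↓ proj₁ x)
          flatten = mk↣ {to = λ z → proj₁ (proj₁ z) , ∈↓ (OrderLemmas.↓-< (Λ⁺ ↓ y) {x} z)}
            λ eq → El-≡ (El-≡ (cong proj₁ eq))

    embedΛ : ∀ i x → Dec (x < i) → Λ.Carrier → Λ.Carrier
    embedΛ i x (yes x<i) _ = Injection.to (↓-↣Λ i) (x , ∈↓ x<i)
    embedΛ i x (no _)    d = d

    ↓-enumeration : Λ.Carrier → Σ[ h ∈ (Carrier → Carrier → Λ.Carrier) ]
      (∀ i {x y} → x < i → y < i → h i x ≡ h i y → x ≡ y)
    ↓-enumeration d = (λ i x → embedΛ i x (x <? i) d) , λ i x<i y<i → inj i (_ <? i) (_ <? i) x<i y<i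
      where
      inj : ∀ i {x y} (p : Dec (x < i)) (q : Dec (y < i)) → x < i → y < i →
            embedΛ i x p d ≡ embedΛ i y q d → x ≡ y
      inj i (yes _) (yes _) _ _ eq = cong proj₁ (Injection.injective (↓-↣Λ i) eq)
      inj i (no x≮i) _ x<i _ _ = ⊥-elim (x≮i x<i)
      inj i (yes _) (no y≮i) _ y<i _ = ⊥-elim (y≮i y<i)

  -- Coherent relations on the successor cardinal.

  module CoherentRelations
    (Λ : WellOrder ℓ) (reg : IsRegularCardinal Λ) (Λ⁺ : WellOrder ℓ)
    (h : WellOrder.Carrier Λ⁺ → WellOrder.Carrier Λ⁺ → WellOrder.Carrier Λ)
    (h-injective : ∀ i {x y} → WellOrder._<_ Λ⁺ x i → WellOrder._<_ Λ⁺ y i → h i x ≡ h i y → x ≡ y)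
    where
    open WellOrder Λ⁺
    open OrderLemmas Λ⁺
    open Regular Λ reg
    private
      module Λ where
        open WellOrder Λ public
        open OrderLemmas Λ public

    -- h i is strictly increasing on C i, so this is a cofinal subset of i of order type at most Λ.
    C : Carrier → Carrier → Set ℓ
    C i ξ = ξ < i × (∀ η → η < i → h i η Λ.< h i ξ → η < ξ)

    -- ρ (j , i) ≤ α, for a subadditive function ρ defined by walks along C as in Todorcevic's
    -- construction.
    data R (α : Λ.Carrier) : Carrier → Carrier → Set ℓ where
      via : ∀ {i j} ξ → C i ξ → h i ξ Λ.< α →
            (∀ η η′ → C i η → C i η′ → η < η′ → ¬ (ξ < η′) → R α η η′) →
            j ≡ ξ ⊎ R α j ξ → R α j i

    R⇒< : ∀ {α j i} → R α j i → j < i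
    R⇒< (via ξ (ξ<i , _) _ _ (inj₁ refl)) = ξ<i
    R⇒< (via ξ (ξ<i , _) _ _ (inj₂ r))    = <-trans (R⇒< r) ξ<i

    R-mono : ∀ {α β j i} → ¬ (β Λ.< α) → R α j i → R β j i
    R-mono α≤β (via ξ c p q (inj₁ e)) =
      via ξ c (Λ.<-≤-trans p α≤β) (λ η η′ a b l m → R-mono α≤β (q η η′ a b l m)) (inj₁ e)
    R-mono α≤β (via ξ c p q (inj₂ r)) =
      via ξ c (Λ.<-≤-trans p α≤β) (λ η η′ a b l m → R-mono α≤β (q η η′ a b l m)) (inj₂ (R-mono α≤β r))

    R-trans : ∀ {α j k i} → R α j k → R α k i → R α j i
    R-trans s (via ξ c p q (inj₁ refl)) = via ξ c p q (inj₂ s)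
    R-trans s (via ξ c p q (inj₂ r))    = via ξ c p q (inj₂ (R-trans s r))

    -- The two walks from `i` first step to points `ξ` and `η` of `C i`. The chain condition at the
    -- larger one relates the smaller to it, so both walks can pass through the larger, where
    -- induction applies.
    R-coherent : ∀ {α} i {j k} → j < k → R α j i → R α k i → R α j k
    R-coherent {α} = All.wfRec wellFounded ℓ
        (λ i → ∀ {j k} → j < k → R α j i → R α k i → R α j k) step
      where
      step : ∀ i → (∀ {ξ} → ξ < i → ∀ {j k} → j < k → R α j ξ → R α k ξ → R α j k) →
             ∀ {j k} → j < k → R α j i → R α k i → R α j k
      step i ih {j} {k} j<k (via ξ cξ _ qξ x) (via η cη _ qη y) with compare ξ η
      ... | tri≈ _ refl _ = top x y
        where
        top : j ≡ ξ ⊎ R α j ξ → k ≡ ξ ⊎ R α k ξ → R α j k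
        top (inj₁ refl) (inj₁ refl) = ⊥-elim (<-irrefl refl j<k)
        top (inj₁ refl) (inj₂ s)    = ⊥-elim (asym j<k (R⇒< s))
        top (inj₂ r)    (inj₁ refl) = r
        top (inj₂ r)    (inj₂ s)    = ih (proj₁ cξ) j<k r s
      ... | tri< ξ<η _ _ = top (lift x) y
        where
        ξRη = qη ξ η cξ cη ξ<η (<-irrefl refl)
        lift : j ≡ ξ ⊎ R α j ξ → R α j η
        lift (inj₁ refl) = ξRη
        lift (inj₂ r)    = R-trans r ξRη
        top : R α j η → k ≡ η ⊎ R α k η → R α j k
        top r (inj₁ refl) = r
        top r (inj₂ s)    = ih (proj₁ cη) j<k r s
      ... | tri> _ _ η<ξ = top x (lift y)
        where
        ηRξ = qξ η ξ cη cξ η<ξ (<-irrefl refl)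
        lift : k ≡ η ⊎ R α k η → R α k ξ
        lift (inj₁ refl) = ηRξ
        lift (inj₂ s)    = R-trans s ηRξ
        top : j ≡ ξ ⊎ R α j ξ → R α k ξ → R α j k
        top (inj₁ refl) s = ⊥-elim (asym j<k (R⇒< s))
        top (inj₂ r)    s = ih (proj₁ cξ) j<k r s

    -- As `h i` is injective below `i`, the relevant `ξ` are indexed by the points below `α`, and
    -- regularity bounds `f` on them.
    h-bounded : ∀ i α (f : Carrier → Λ.Carrier) → ∃[ b ] (∀ ξ → ξ < i → h i ξ Λ.< α → f ξ Λ.< b)
    h-bounded i α f = proj₁ bound , λ ξ ξ<i hξ<α →
        subst (Λ._< proj₁ bound) (inverse-≡ em ξ<i) (proj₂ bound (h i ξ) hξ<α)
      where
      inverse : ∀ z → Dec (∃[ ξ ] ξ < i × h i ξ ≡ z) → Λ.Carrier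
      inverse z (yes (ξ , _)) = f ξ
      inverse z (no _)        = zeroΛ
      inverse-≡ : ∀ {ξ} d → ξ < i → inverse (h i ξ) d ≡ f ξ
      inverse-≡ (yes (ξ′ , ξ′<i , e)) ξ<i = cong f (h-injective i ξ′<i ξ<i e)
      inverse-≡ (no ∄ξ) ξ<i = ⊥-elim (∄ξ (_ , ξ<i , refl))
      bound = bounded α λ z → inverse z em

    -- Each `R α`-predecessor of `i` is, or lies `R α`-below, some `ξ` with `h i ξ` below `α`.
    -- Induction bounds `f` below each such `ξ`, and `h-bounded` merges the bounds.
    R-bounded : ∀ i α (f : Carrier → Λ.Carrier) → ∃[ b ] (∀ j → R α j i → f j Λ.< b)
    R-bounded = All.wfRec wellFounded ℓ
        (λ i → ∀ α (f : Carrier → Λ.Carrier) → ∃[ b ] (∀ j → R α j i → f j Λ.< b)) step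
      where
      step : ∀ i → (∀ {ξ} → ξ < i → ∀ α f → ∃[ b ] (∀ j → R α j ξ → f j Λ.< b)) →
             ∀ α f → ∃[ b ] (∀ j → R α j i → f j Λ.< b)
      step i ih α f = b , λ j → j<b
        where
        inner : ∀ ξ → Dec (ξ < i) → ∃[ b ] (ξ < i → ∀ j → R α j ξ → f j Λ.< b)
        inner ξ (yes ξ<i) = let b , h = ih ξ<i α f in b , λ _ → h
        inner ξ (no ξ≮i)  = zeroΛ , λ ξ<i → ⊥-elim (ξ≮i ξ<i)
        outer = h-bounded i α λ ξ → Λ.max (f ξ) (proj₁ (inner ξ (ξ <? i)))
        b = proj₁ outer
        j<b : ∀ {j} → R α j i → f j Λ.< b
        j<b (via ξ (ξ<i , _) p _ (inj₁ refl)) =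
          Λ.≤-<-trans (proj₁ (Λ.max-≤ _ _)) (proj₂ outer ξ ξ<i p)
        j<b {j} (via ξ (ξ<i , _) p _ (inj₂ r)) = Λ.<-trans
          (Λ.<-≤-trans (proj₂ (inner ξ (ξ <? i)) ξ<i j r) (proj₂ (Λ.max-≤ (f ξ) _)))
          (proj₂ outer ξ ξ<i p)

    -- The witness is the point between `j` and `i` with least `h i`-value.
    C-cofinal : ∀ {i j} → j < i → ∃[ ξ ] C i ξ × ¬ (ξ < j)
    C-cofinal {i} {j} j<i =
      let _ , (ξ , ξ<i , ξ≮j , eq) , least =
            minimum Λ (λ z → ∃[ ξ ] ξ < i × ¬ (ξ < j) × h i ξ ≡ z) (h i j , j , j<i , <-irrefl refl , refl)
      in ξ , (ξ<i , λ η η<i hη<hξ → <-≤-trans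
            (dne λ η≮j → least (h i η) (η , η<i , η≮j , refl) (subst (h i η Λ.<_) eq hη<hξ)) ξ≮j) , ξ≮j

    h-mono-C : ∀ {i ξ η} → C i ξ → C i η → ¬ (ξ < η) → ¬ (h i ξ Λ.< h i η)
    h-mono-C (ξ<i , _) (_ , cη) ξ≮η hξ<hη = ξ≮η (cη _ ξ<i hξ<hη)

    R-total : ∀ i {j} → j < i → ∃[ α ] R α j i
    R-total = All.wfRec wellFounded ℓ (λ i → ∀ {j} → j < i → ∃[ α ] R α j i) step
      where
      step : ∀ i → (∀ {k} → k < i → ∀ {j} → j < k → ∃[ α ] R α j k) → ∀ {j} → j < i → ∃[ α ] R α j i
      step i ih {j} j<i = α , via ξ cξ (Λ.<-≤-trans hξ<α₀ α₀≤α) chain (last (≤⇒<⊎≡ ξ≮j))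
        where
        ρ-dec : ∀ j k → Dec (j < k × k < i) → ∃[ α ] (j < k → k < i → R α j k)
        ρ-dec j k (yes (j<k , k<i)) = let α , r = ih k<i j<k in α , λ _ _ → r
        ρ-dec j k (no n)            = zeroΛ , λ j<k k<i → ⊥-elim (n (j<k , k<i))
        ρ-spec = λ j k → ρ-dec j k em
        ρ : Carrier → Carrier → Λ.Carrier
        ρ j k = proj₁ (ρ-spec j k)
        ξ = proj₁ (C-cofinal j<i)
        cξ = proj₁ (proj₂ (C-cofinal j<i))
        ξ≮j = proj₂ (proj₂ (C-cofinal j<i))
        α₀ = proj₁ (noMax (h i ξ))
        hξ<α₀ = proj₂ (noMax (h i ξ))
        inner : ∀ k → ∃[ b ] (∀ η → η < i → h i η Λ.< α₀ → ρ η k Λ.< b)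
        inner k = h-bounded i α₀ λ η → ρ η k
        outer : ∃[ b ] (∀ k → k < i → h i k Λ.< α₀ → proj₁ (inner k) Λ.< b)
        outer = h-bounded i α₀ λ k → proj₁ (inner k)
        b = proj₁ outer
        -- `b` serves the chain condition for all pairs in `C i` up to `ξ`, `α₀` the bound on
        -- `h i ξ`, and `ρ j ξ` the rest of the walk down to `j`.
        α = Λ.max b (Λ.max α₀ (ρ j ξ))
        α₀≤α : ¬ (α Λ.< α₀)
        α₀≤α = Λ.≤-trans (proj₁ (Λ.max-≤ α₀ (ρ j ξ))) (proj₂ (Λ.max-≤ b _))
        h<α₀ : ∀ {η} → C i η → ¬ (ξ < η) → h i η Λ.< α₀
        h<α₀ cη ξ≮η = Λ.≤-<-trans (h-mono-C cξ cη ξ≮η) hξ<α₀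
        chain : ∀ η η′ → C i η → C i η′ → η < η′ → ¬ (ξ < η′) → R α η η′
        chain η η′ cη cη′ η<η′ ξ≮η′ = R-mono (Λ.asym ρ<α) (proj₂ (ρ-spec η η′) η<η′ (proj₁ cη′))
          where
          ρ<α : ρ η η′ Λ.< α
          ρ<α = Λ.<-≤-trans
            (Λ.<-trans (proj₂ (inner η′) η (proj₁ cη) (h<α₀ cη (λ ξ<η → ξ≮η′ (<-trans ξ<η η<η′))))
                       (proj₂ outer η′ (proj₁ cη′) (h<α₀ cη′ ξ≮η′)))
            (proj₁ (Λ.max-≤ b _))
        last : j < ξ ⊎ j ≡ ξ → j ≡ ξ ⊎ R α j ξ
        last (inj₁ j<ξ) = inj₂ (R-mono (Λ.≤-trans (proj₂ (Λ.max-≤ α₀ (ρ j ξ))) (proj₂ (Λ.max-≤ b _)))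
                                       (proj₂ (ρ-spec j ξ) j<ξ (proj₁ cξ)))
        last (inj₂ j≡ξ) = inj₁ j≡ξ

    -- The colours of the `R α`-predecessors of `i` are bounded, so the bound itself is a fresh
    -- colour.
    R-colouring : ∀ α → Σ[ g ∈ (Carrier → Λ.Carrier) ] (∀ {j i} → R α j i → g j ≢ g i)
    R-colouring α = greedy (R α) (λ _ → zeroΛ) (Subrelation.wellFounded R⇒< wellFounded) λ i f →
      let b , f<b = R-bounded i α f in b , λ j r eq → Λ.<-irrefl eq (f<b j r)

    R-related-≢ : ∀ {α i j k} → R α j i → R α k i → j ≢ k →
                  proj₁ (R-colouring α) j ≢ proj₁ (R-colouring α) k
    R-related-≢ {α} {i} {j} {k} r s j≢k = separate (compare j k)
      where
      separate : Tri (j < k) (j ≡ k) (k < j) →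
                 proj₁ (R-colouring α) j ≢ proj₁ (R-colouring α) k
      separate (tri< j<k _ _) = proj₂ (R-colouring α) (R-coherent i j<k r s)
      separate (tri≈ _ j≡k _) = ⊥-elim (j≢k j≡k)
      separate (tri> _ _ k<j) = λ eq → proj₂ (R-colouring α) (R-coherent i k<j s r) (sym eq)

  -- Values at a single set

  unbounded⇒infinite : (A : WellOrder ℓ) → let open WellOrder A in
                       (∀ a → ∃[ b ] a < b) → Carrier → ℕ ↣ Carrier
  unbounded⇒infinite A above a₀ = mk↣ {to = s} λ {m} {n} eq → separate eq (<-cmp m n)
    where
    open WellOrder A
    s : ℕ → Carrier
    s zero    = a₀
    s (suc n) = proj₁ (above (s n))
    s-mono : ∀ {m n} → m <′ n → s m < s n
    s-mono <′-base       = proj₂ (above _)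
    s-mono (≤′-step m<n) = <-trans (s-mono m<n) (proj₂ (above _))
    separate : ∀ {m n} → s m ≡ s n → Tri (m ℕ.< n) (m ≡ n) (n ℕ.< m) → m ≡ n
    separate eq (tri< m<n _ _) = ⊥-elim (<-irrefl eq (s-mono (≤⇒≤′ m<n)))
    separate eq (tri≈ _ m≡n _) = m≡n
    separate eq (tri> _ _ n<m) = ⊥-elim (<-irrefl (sym eq) (s-mono (≤⇒≤′ n<m)))

  module _ (Λ : WellOrder ℓ) (u : 𝒫 (WellOrder.Carrier Λ)) where
    open WellOrder Λ
    private
      A = Λ ↾ u
      K = card A

    NoMax : Set ℓ
    NoMax = ∀ (a : El u) → ∃[ b ] WellOrder._<_ A a b

    -- Otherwise φ and the bounds of the sets { a ∣ φ a ≤ ε } are convergent maps between sup u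
    -- and |u|, which makes the two cofinalities equal.
    cofinal-fibre : ¬ (cf (sup Λ u) ≅ cf K) → NoMax → (φ : El u → WellOrder.Carrier K) →
      ∃[ ε ] (∀ a → ∃[ a′ ] ¬ (proj₁ a′ < proj₁ a) × ¬ (WellOrder._<_ K ε (φ a′)))
    cofinal-fibre cf≇ noMax φ = find λ none →
      let bound : Bounds
          bound ε = find λ h → none ε λ a → find λ k → h a λ a′ a≤a′ → dne λ ε≮ → k a′ (a≤a′ , ε≮)
      in cf≇ (↪-antisym (sup→K bound) (K→sup bound))
      where
      open OrderLemmas Λ using (≤-<-trans; <-≤-trans; asym)
      S = sup Λ u
      Bounds : Set ℓ
      Bounds = ∀ (ε : WellOrder.Carrier K) → Σ[ a ∈ El u ]
        (∀ (a′ : El u) → ¬ (proj₁ a′ < proj₁ a) → WellOrder._<_ K ε (φ a′))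
      InSup : Carrier → Set ℓ
      InSup β = ∃[ α ] α ∈ u × β < α
      up : WellOrder.Carrier S → El u
      up (β , β∈) = let α , α∈u , _ = compr-∈ InSup β∈ in α , α∈u
      <up : ∀ s → proj₁ s < proj₁ (up s)
      <up (β , β∈) = proj₂ (proj₂ (compr-∈ InSup β∈))
      toS : El u → WellOrder.Carrier S
      toS a = proj₁ a , ∈-compr InSup (let b , a<b = noMax a in proj₁ b , proj₂ b , a<b)
      module _ (bound : Bounds) where
        K→sup : cf K ↪ cf S
        K→sup = convergent⇒cf-↪ {K} {S} (φ ∘ up) λ ε → toS (proj₁ (bound ε)) , λ s s≮ →
          OrderLemmas.asym K {ε} {φ (up s)} (proj₂ (bound ε) (up s) (asym (≤-<-trans s≮ (<up s))))
        sup→K : cf S ↪ cf K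
        sup→K = convergent⇒cf-↪ {S} {K} (λ ε → toS (proj₁ (bound ε))) λ s → φ (up s) , λ ε ε≮φ lt →
          ε≮φ (proj₂ (bound ε) (up s) (asym (<-trans lt (<up s))))

    module OnSet
      (cf≇ : ¬ (cf (sup Λ u) ≅ cf K)) (noMax : NoMax) (a₀ : El u)
      (I : WellOrder ℓ)
      (R : Carrier → WellOrder.Carrier I → WellOrder.Carrier I → Set ℓ)
      (R⇒< : ∀ {α j i} → R α j i → WellOrder._<_ I j i)
      (R-mono : ∀ {α β j i} → ¬ (β < α) → R α j i → R β j i)
      (g : Carrier → WellOrder.Carrier I → Carrier)
      (g-≢ : ∀ {α i j k} → R α j i → R α k i → j ≢ k → g α j ≢ g α k)
      where
      private
        Index = WellOrder.Carrier I
        module K where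
          open WellOrder K public
          open OrderLemmas K public
        open Injection (card-↣ A) using () renaming (to to rank; injective to rank-injective)
        infinite : ℕ ↣ El u
        infinite = unbounded⇒infinite A noMax a₀

      ClosedUnder : Index → Set ℓ
      ClosedUnder j = ∀ (a : El u) → g (proj₁ a) j ∈ u

      Sees : Index → Index → Set ℓ
      Sees j i = Σ[ a ∈ El u ] R (proj₁ a) j i

      private
        -- The fallback `a` only makes the map total on `u`; it does not occur when `u` is closed
        -- under `g` at `j`.
        image-dec : ∀ j (a : El u) → Dec (g (proj₁ a) j ∈ u) → El u
        image-dec j a (yes m) = g (proj₁ a) j , m
        image-dec j a (no _)  = a

        image : Index → El u → El u
        image j a = image-dec j a (T? _)

        image-≡ : ∀ j a d → g (proj₁ a) j ∈ u → proj₁ (image-dec j a d) ≡ g (proj₁ a) j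
        image-≡ j a (yes _) _ = refl
        image-≡ j a (no n)  m = ⊥-elim (n m)

        φ : Index → El u → K.Carrier
        φ i a = K.max (rank a) (rank (image i a))

        fibre : ∀ i → ∃[ ε ] (∀ a → ∃[ a′ ] ¬ (proj₁ a′ < proj₁ a) × ¬ (ε K.< φ i a′))
        fibre i = cofinal-fibre cf≇ noMax (φ i)

        ε : Index → K.Carrier
        ε i = proj₁ (fibre i)

      Rival : Index → Index → Set ℓ
      Rival j i = Sees j i × ClosedUnder j × ε j ≡ ε i

      private
        -- Here the rivals of `i` are assumed to use up all labels in `u`. Choosing a rival for each
        -- label would inject `u` into the square of the ranks up to `ε i`, and so into a proper
        -- initial segment of its cardinal.
        module _ (i : Index) (f : Index → El u) (pre : ∀ y → ∃[ j ] Rival j i × f j ≡ y) where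
          j : El u → Index
          j y = proj₁ (pre y)
          seen : ∀ y → Sees (j y) i
          seen y = proj₁ (proj₁ (proj₂ (pre y)))
          point : ∀ y → ∃[ a ] ¬ (proj₁ a < proj₁ (proj₁ (seen y))) × ¬ (ε (j y) K.< φ (j y) a)
          point y = proj₂ (fibre (j y)) (proj₁ (seen y))
          α : El u → El u
          α y = proj₁ (point y)
          related : ∀ y → R (proj₁ (α y)) (j y) i
          related y = R-mono (proj₁ (proj₂ (point y))) (proj₂ (seen y))
          φ≤ε : ∀ y → ¬ (ε i K.< φ (j y) (α y))
          φ≤ε y = subst (λ e → ¬ (e K.< φ (j y) (α y))) (proj₂ (proj₂ (proj₁ (proj₂ (pre y)))))
                    (proj₂ (proj₂ (point y)))
          g≡ : ∀ y → proj₁ (image (j y) (α y)) ≡ g (proj₁ (α y)) (j y)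
          g≡ y = image-≡ (j y) (α y) (T? _) (proj₁ (proj₂ (proj₁ (proj₂ (pre y)))) (α y))
          ψ : El u → K.Carrier × K.Carrier
          ψ y = rank (α y) , rank (image (j y) (α y))
          ψ-injective : ∀ {y z} → ψ y ≡ ψ z → y ≡ z
          ψ-injective {y} {z} eq = trans (sym (proj₂ (proj₂ (pre y))))
              (trans (cong f (dne j≢⇒⊥)) (proj₂ (proj₂ (pre z))))
            where
            α≡ : proj₁ (α y) ≡ proj₁ (α z)
            α≡ = cong proj₁ (rank-injective (cong proj₁ eq))
            j≢⇒⊥ : ¬ ¬ (j y ≡ j z)
            -- Equal pairs share the point `a` and the value of `g a`, while `g a` separates
            -- distinct indices `R a`-below `i`.
            j≢⇒⊥ j≢ = g-≢ (related y) (subst (λ a → R a (j z) i) (sym α≡) (related z)) j≢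
              (trans (sym (g≡ y)) (trans (cong proj₁ (rank-injective (cong proj₂ eq)))
                (trans (g≡ z) (cong (λ a → g a (j z)) (sym α≡)))))
          tooMany : ⊥
          tooMany = card-initial A (ε i) (square≤⇒↓ K infinite (square (K ↓ ε i))
            (mk↣ {to = ψ} ψ-injective , λ y →
              let r₁ , r₂ = ψ y
                  r₁≤φ , r₂≤φ = K.max-≤ r₁ r₂
              in K.≤-trans {r₁} {φ (j y) (α y)} {ε i} r₁≤φ (φ≤ε y) ,
                 K.≤-trans {r₂} {φ (j y) (α y)} {ε i} r₂≤φ (φ≤ε y)))

        label : Σ[ δ ∈ (Index → El u) ] (∀ {j i} → Rival j i → δ j ≢ δ i)
        label = greedy Rival (λ _ → a₀)
          (Subrelation.wellFounded (λ r → R⇒< (proj₂ (proj₁ r))) (WellOrder.wellFounded I))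
          λ i f → find λ h → tooMany i f λ y → find λ n → h y λ j r e → n j (r , e)

        pair : (El u × El u) ↣ El u
        pair = square A infinite

      value : Index → El u
      -- A point of `card A` is a point of `A` with a proof, so `proj₁ (ε i)` is itself a member of
      -- `u`.
      value i = Injection.to pair (proj₁ (ε i) , proj₁ label i)

      value-≢ : ∀ {j i} → Sees j i → ClosedUnder j → value j ≢ value i
      value-≢ sees closed eq =
        let e = Injection.injective pair eq
        in proj₂ label (sees , closed , El-≡ (cong proj₁ e)) (cong proj₂ e)

    -- For empty `u` both cofinalities are empty, hence isomorphic.
    sup≇card⇒nonempty : ¬ (cf (sup Λ u) ≅ cf K) → El u
    sup≇card⇒nonempty cf≇ = dne λ empty → cf≇ (↪-antisym {cf (sup Λ u)} {cf K}
      (embed (λ s → ⊥-elim (supEmpty empty (proj₁ s))) λ {s} → ⊥-elim (supEmpty empty (proj₁ s)))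
      (embed (λ k → ⊥-elim (empty (proj₁ (proj₁ k)))) λ {k} → ⊥-elim (empty (proj₁ (proj₁ k)))))
      where
      supEmpty : ¬ El u → ¬ WellOrder.Carrier (sup Λ u)
      supEmpty empty (β , β∈) =
        let α , α∈u , _ = compr-∈ (λ β → ∃[ α ] α ∈ u × β < α) {β} β∈ in empty (α , α∈u)

  -- The family of functions

  module Family
    (Λ : WellOrder ℓ) {d : Level}
    (𝒟 : Pred (𝒫 (El (𝒰 Λ))) d) (isFilter : IsFilter 𝒟)
    (fine : IsFine Λ (𝒰 Λ) 𝒟) (normal : IsNormal Λ (𝒰 Λ) 𝒟)
    (above : ∀ a → ∃[ b ] WellOrder._<_ Λ a b)
    (I : WellOrder ℓ)
    (R : WellOrder.Carrier Λ → WellOrder.Carrier I → WellOrder.Carrier I → Set ℓ)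
    (R⇒< : ∀ {α j i} → R α j i → WellOrder._<_ I j i)
    (R-mono : ∀ {α β j i} → ¬ (WellOrder._<_ Λ β α) → R α j i → R β j i)
    (R-total : ∀ i {j} → WellOrder._<_ I j i → ∃[ α ] R α j i)
    (g : WellOrder.Carrier Λ → WellOrder.Carrier I → WellOrder.Carrier Λ)
    (g-≢ : ∀ {α i j k} → R α j i → R α k i → j ≢ k → g α j ≢ g α k)
    where
    open WellOrder Λ using (Carrier)
    open WellOrder I using () renaming (Carrier to Index; _<_ to _<ᴵ_; compare to compareᴵ)
    open IsFilter isFilter

    𝒰-cf≇ : (u : El (𝒰 Λ)) → ¬ (cf (sup Λ (proj₁ u)) ≅ cf (card (Λ ↾ proj₁ u)))
    𝒰-cf≇ (u , u∈) = compr-∈ (λ u → ¬ (cf (sup Λ u) ≅ cf (card (Λ ↾ u)))) {u} u∈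

    base : (u : El (𝒰 Λ)) → El (proj₁ u)
    base u = sup≇card⇒nonempty Λ (proj₁ u) (𝒰-cf≇ u)

    module At (u : El (𝒰 Λ)) (noMax : NoMax Λ (proj₁ u)) =
      OnSet Λ (proj₁ u) (𝒰-cf≇ u) noMax (base u) I R R⇒< R-mono g g-≢

    -- A set `u` with a maximum gets an arbitrary constant value; such sets are negligible by
    -- normality.
    value-dec : (u : El (𝒰 Λ)) → Dec (NoMax Λ (proj₁ u)) → Index → El (proj₁ u)
    value-dec u (yes noMax) i = At.value u noMax i
    value-dec u (no _)      i = base u

    value-dec-≢ : ∀ u noMax? {j i} → NoMax Λ (proj₁ u) →
                  Σ[ a ∈ El (proj₁ u) ] R (proj₁ a) j i →
                  (∀ (a : El (proj₁ u)) → g (proj₁ a) j ∈ proj₁ u) →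
                  proj₁ (value-dec u noMax? j) ≢ proj₁ (value-dec u noMax? i)
    value-dec-≢ u (yes noMax) _ sees closed eq = At.value-≢ u noMax sees closed (El-≡ eq)
    value-dec-≢ u (no max) noMax _ _ = ⊥-elim (max noMax)

    f : Index → El (𝒰 Λ) → Carrier
    f i u = proj₁ (value-dec u em i)

    f∈ : ∀ i u → f i u ∈ proj₁ u
    f∈ i u = proj₂ (value-dec u em i)

    -- The diagonal intersection of the sets given by fineness at `s α` consists of the `u` closed
    -- under `s`.
    closed-𝒟 : (s : Carrier → Carrier) → 𝒟 (diagonal Λ (𝒰 Λ) 𝒟 (λ α u → proj₁ u (s α)))
    closed-𝒟 s = normal (λ α u → proj₁ u (s α)) λ α → fine (s α)

    closed : (s : Carrier → Carrier) (u : El (𝒰 Λ)) → u ∈ diagonal Λ (𝒰 Λ) 𝒟 (λ α u → proj₁ u (s α)) →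
             ∀ (a : El (proj₁ u)) → s (proj₁ a) ∈ proj₁ u
    closed s u u∈ (a , a∈) =
      compr-∈ (λ (u : El (𝒰 Λ)) → ∀ α → α ∈ proj₁ u → u ∈ (λ u → proj₁ u (s α))) {u} u∈ a a∈

    -- Almost every `u` contains a point `α` with `R α j i`, is closed under `g` at `j`, and is
    -- closed under a map moving every point up, hence has no maximum. The arbitrary `X` allows
    -- either orientation of the inequality.
    almost-≢ : ∀ {j i} → j <ᴵ i → ∀ {X : 𝒫 (El (𝒰 Λ))} → ((u : El (𝒰 Λ)) → f j u ≢ f i u → u ∈ X) → 𝒟 X
    almost-≢ {j} {i} j<i {X} ≢⇒X =
      upward (intersection (fine α) (intersection (closed-𝒟 s) (closed-𝒟 (λ a → g a j)))) separates
      where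
      α = proj₁ (R-total i j<i)
      s : Carrier → Carrier
      s a = proj₁ (above a)
      separates : ((λ u → proj₁ u α) ∩ (diagonal Λ (𝒰 Λ) 𝒟 (λ a u → proj₁ u (s a)) ∩
                   diagonal Λ (𝒰 Λ) 𝒟 (λ a u → proj₁ u (g a j)))) ⊆ X
      separates u u∈ =
        let α∈u , u∈′ = ∈-∩ u∈
            s-closed , g-closed = ∈-∩ u∈′
        in ≢⇒X u (value-dec-≢ u em
             (λ a → (s (proj₁ a) , closed s u s-closed a) , proj₂ (above (proj₁ a)))
             ((α , α∈u) , proj₂ (R-total i j<i))
             (closed (λ a → g a j) u g-closed))
        where
        ∈-∩ : ∀ {x y} → T (x ∧ y) → T x × T y
        ∈-∩ = Equivalence.to T-∧

    f-≢ : ∀ i j → i ≢ j → 𝒟 ｛ u ∣ f i u ≢ f j u ｝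
    f-≢ i j i≢j = separate (compareᴵ i j)
      where
      Separated : El (𝒰 Λ) → Set ℓ
      Separated u = f i u ≢ f j u
      separate : Tri (i <ᴵ j) (i ≡ j) (j <ᴵ i) → 𝒟 (compr Separated)
      separate (tri< i<j _ _) = almost-≢ i<j λ u ≢ → ∈-compr Separated {u} ≢
      separate (tri≈ _ i≡j _) = ⊥-elim (i≢j i≡j)
      separate (tri> _ _ j<i) = almost-≢ j<i λ u ≢ → ∈-compr Separated {u} (≢ ∘ sym)

theorem4p1 : ∀ {ℓ d} (em : ExcludedMiddle ℓ) → Extensionality ℓ ℓ →
    let open Classical em in
    (Λ : WellOrder ℓ) → IsRegularCardinal Λ →
    (𝒟 : Pred (𝒫 (El (𝒰 Λ))) d) → IsFilter 𝒟 →
    IsFine Λ (𝒰 Λ) 𝒟 → IsNormal Λ (𝒰 Λ) 𝒟 →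
    (Λ⁺ : WellOrder ℓ) → IsSuccessorCardinal Λ Λ⁺ →
    Σ[ f ∈ (WellOrder.Carrier Λ⁺ → El (𝒰 Λ) → WellOrder.Carrier Λ) ]
    (∀ i u → f i u ∈ proj₁ u) ×
    (∀ i j → i ≢ j → 𝒟 ｛ u ∣ f i u ≢ f j u ｝)
theorem4p1 em ext Λ reg 𝒟 isFilter fine normal Λ⁺ isSuc = F.f , F.f∈ , F.f-≢
  where
  open Lemmas em ext
  open Regular Λ reg using (zeroΛ; noMax)
  -- `zeroΛ` is the junk value of the enumeration at `i` for points not below `i`.
  enumeration = Successor.↓-enumeration isSuc zeroΛ
  open CoherentRelations Λ reg Λ⁺ (proj₁ enumeration) (proj₂ enumeration)
  module F = Family Λ 𝒟 isFilter fine normal noMax Λ⁺ R R⇒< R-mono R-total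
               (λ α → proj₁ (R-colouring α)) R-related-≢
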